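{- Let $G$ be a graph of order $n$ with maximum degree $\Delta\ge 1$. Then $$\gamma_{rdR}(G)\ge \frac{2n+(\Delta-2)\gamma_r(G)}{\Delta}.$$ Moreover, the bound is sharp: for every integer $\Delta\ge 4$ there is a graph with maximum degree $\Delta$ attaining equality.
   Context: All graphs are finite and simple. An RDRD function of $G$ is a function $f:V(G)\to\{0,1,2,3\}$ such that every vertex with value $0$ has at least two neighbors with value $2$ or at least one neighbor with value $3$, every vertex with value $1$ has a neighbor with value $2$ or $3$, and the subgraph induced by the vertices with value $0$ has no isolated vertices; $\gamma_{rdR}(G)$ is the minimum of $\sum_v f(v)$ over RDRD functions. A restrained dominating set of $G$ is a set $S\subseteq V(G)$ such that every vertex of $V(G)\setminus S$ has a neighbor in $S$ and a neighbor in $V(G)\setminus S$; $\gamma_r(G)$ is the minimum cardinality of such a set. -}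

module Defs where

open import Data.Empty using (⊥-elim)
open import Data.Fin using (Fin; toℕ; finToFun; funToFin)
open import Data.Fin.Patterns using (0F; 1F; 2F; 3F)
open import Data.Fin.Properties using (any?; all?; finToFun-funToFin)
  renaming (_≟_ to _≟ᶠ_)
open import Data.Fin.Subset using (Subset; _∈_; _∉_; ∣_∣; ⊤)
open import Data.Fin.Subset.Properties using (_∈?_; anySubset?; ∈⊤)
open import Data.Nat using (ℕ; _≤_; _<_; _⊔_; _≟_)
open import Data.Nat.Induction using (<-rec)
open import Data.Nat.Properties using (+-0-monoid; anyUpTo?; ≮⇒≥)
open import Data.Product using (∃; ∃-syntax; _×_; _,_; proj₁; proj₂)
open import Data.Sum using (_⊎_; inj₁; inj₂)
open import Data.Vec using (tabulate)
open import Data.Vec.Functional using (foldr)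
open import Function using (_∘_)
open import Level using (0ℓ)
open import Relation.Binary using (Rel; Symmetric; Irreflexive) renaming (Decidable to Decidable₂)
open import Relation.Binary.PropositionalEquality using (_≡_; _≢_; refl; sym; trans; cong; _≗_)
open import Relation.Nullary using (Dec; yes; no; does; ¬?; _×-dec_; _⊎-dec_; _→-dec_)
open import Relation.Nullary.Decidable using (map′)
open import Relation.Unary using (Pred; Decidable)
open import Algebra.Properties.Monoid.Sum +-0-monoid using (sum; sum-cong-≗)

-- Decidable adjacency makes degrees and the minima below actual natural numbers;
-- classically it is no restriction on finite simple graphs.
record Graph (n : ℕ) : Set₁ where
  infix 4 _~_ _~?_
  field
    _~_      : Rel (Fin n) 0ℓ
    ~-sym    : Symmetric _~_
    ~-irrefl : Irreflexive _≡_ _~_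
    _~?_     : Decidable₂ _~_

weight : ∀ {n} → (Fin n → Fin 4) → ℕ
weight f = sum (toℕ ∘ f)

module _ {n : ℕ} (G : Graph n) where
  open Graph G

  neighbours : Fin n → Subset n
  neighbours v = tabulate (λ u → does (v ~? u))

  degree : Fin n → ℕ
  degree v = ∣ neighbours v ∣

  -- The seed 0 only matters when n = 0.
  maxDegree : ℕ
  maxDegree = foldr _⊔_ 0 degree

  record IsRDRD (f : Fin n → Fin 4) : Set where
    field
      zero-dominated : ∀ v → f v ≡ 0F →
          (∃[ u ] ∃[ w ] u ≢ w × (v ~ u × f u ≡ 2F) × (v ~ w × f w ≡ 2F))
        ⊎ (∃[ u ] v ~ u × f u ≡ 3F)
      one-dominated  : ∀ v → f v ≡ 1F → ∃[ u ] v ~ u × (f u ≡ 2F ⊎ f u ≡ 3F)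
      -- The subgraph induced by f ⁻¹ 0 has no isolated vertices.
      restrained     : ∀ v → f v ≡ 0F → ∃[ u ] v ~ u × f u ≡ 0F

  IsRestrainedDominating : Subset n → Set
  IsRestrainedDominating S =
    ∀ v → v ∉ S → (∃[ u ] v ~ u × u ∈ S) × (∃[ u ] v ~ u × u ∉ S)

  RDRDWeight : Pred ℕ 0ℓ
  RDRDWeight k = ∃[ f ] IsRDRD f × weight f ≡ k

  RestrainedDominatingSize : Pred ℕ 0ℓ
  RestrainedDominatingSize k = ∃[ S ] IsRestrainedDominating S × ∣ S ∣ ≡ k

IsMinimum : Pred ℕ 0ℓ → Pred ℕ 0ℓ
IsMinimum P k = P k × (∀ m → P m → k ≤ m)

minimum-exists : ∀ {P : Pred ℕ 0ℓ} → Decidable P → ∀ k → P k → ∃ (IsMinimum P)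
minimum-exists {P} P? = <-rec _ step
  where
  step : ∀ k → (∀ {m} → m < k → P m → ∃ (IsMinimum P)) → P k → ∃ (IsMinimum P)
  step k rec pk with anyUpTo? P? k
  ... | yes (m , m<k , pm) = rec m<k pm
  ... | no none            = k , pk , λ m pm → ≮⇒≥ (λ m<k → none (m , m<k , pm))

-- Without function extensionality, searching Fin m → Fin k needs P to respect _≗_.
anyFunction? : ∀ {m k} {P : Pred (Fin m → Fin k) 0ℓ} →
               (∀ {f g} → f ≗ g → P f → P g) → Decidable P → Dec (∃ P)
anyFunction? resp P? =
  map′ (λ (i , p) → finToFun i , p)
       (λ (f , p) → funToFin f , resp (sym ∘ finToFun-funToFin f) p)
       (any? (P? ∘ finToFun))

module _ {n : ℕ} (G : Graph n) where
  open Graph G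

  IsRDRD? : Decidable (IsRDRD G)
  IsRDRD? f =
    map′ (λ (a , b , c) → record { zero-dominated = a ; one-dominated = b ; restrained = c })
         (λ r → IsRDRD.zero-dominated r , IsRDRD.one-dominated r , IsRDRD.restrained r)
         (all? (λ v → (f v ≟ᶠ 0F) →-dec
            (any? (λ u → any? λ w → ¬? (u ≟ᶠ w) ×-dec
               ((v ~? u ×-dec f u ≟ᶠ 2F) ×-dec (v ~? w ×-dec f w ≟ᶠ 2F)))
             ⊎-dec any? (λ u → v ~? u ×-dec f u ≟ᶠ 3F)))
          ×-dec all? (λ v → (f v ≟ᶠ 1F) →-dec
            any? (λ u → v ~? u ×-dec (f u ≟ᶠ 2F ⊎-dec f u ≟ᶠ 3F)))
          ×-dec all? (λ v → (f v ≟ᶠ 0F) →-dec any? (λ u → v ~? u ×-dec f u ≟ᶠ 0F)))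

  IsRDRD-resp : ∀ {f g} → f ≗ g → IsRDRD G f → IsRDRD G g
  IsRDRD-resp {f} {g} f≗g r = record
    { zero-dominated = λ v gv → zd (IsRDRD.zero-dominated r v (from gv))
    ; one-dominated  = λ v gv → od (IsRDRD.one-dominated r v (from gv))
    ; restrained     = λ v gv → let (u , a , fu) = IsRDRD.restrained r v (from gv) in u , a , to fu
    }
    where
    from : ∀ {v i} → g v ≡ i → f v ≡ i
    from {v} = trans (f≗g v)

    to : ∀ {v i} → f v ≡ i → g v ≡ i
    to {v} = trans (sym (f≗g v))

    zd : ∀ {v} →
         (∃[ u ] ∃[ w ] u ≢ w × (v ~ u × f u ≡ 2F) × (v ~ w × f w ≡ 2F)) ⊎ (∃[ u ] v ~ u × f u ≡ 3F) →
         (∃[ u ] ∃[ w ] u ≢ w × (v ~ u × g u ≡ 2F) × (v ~ w × g w ≡ 2F)) ⊎ (∃[ u ] v ~ u × g u ≡ 3F)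
    zd (inj₁ (u , w , u≢w , (a , p) , (b , q))) = inj₁ (u , w , u≢w , (a , to p) , (b , to q))
    zd (inj₂ (u , a , p))                       = inj₂ (u , a , to p)

    od : ∀ {v} → ∃[ u ] v ~ u × (f u ≡ 2F ⊎ f u ≡ 3F) → ∃[ u ] v ~ u × (g u ≡ 2F ⊎ g u ≡ 3F)
    od (u , a , inj₁ p) = u , a , inj₁ (to p)
    od (u , a , inj₂ p) = u , a , inj₂ (to p)

  RDRDWeight? : Decidable (RDRDWeight G)
  RDRDWeight? k = anyFunction?
    (λ f≗g (r , w) → IsRDRD-resp f≗g r , trans (sum-cong-≗ (λ v → cong toℕ (sym (f≗g v)))) w)
    (λ f → IsRDRD? f ×-dec weight f ≟ k)

  rdR-minimum : ∃ (IsMinimum (RDRDWeight G))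
  rdR-minimum = minimum-exists RDRDWeight? _ ((λ _ → 2F) , all-twos , refl)
    where
    all-twos : IsRDRD G (λ _ → 2F)
    all-twos = record { zero-dominated = λ _ () ; one-dominated = λ _ () ; restrained = λ _ () }

  IsRestrainedDominating? : Decidable (IsRestrainedDominating G)
  IsRestrainedDominating? S = all? λ v → ¬? (v ∈? S) →-dec
    (any? (λ u → v ~? u ×-dec u ∈? S) ×-dec any? (λ u → v ~? u ×-dec ¬? (u ∈? S)))

  r-minimum : ∃ (IsMinimum (RestrainedDominatingSize G))
  r-minimum = minimum-exists
    (λ k → anySubset? (λ S → IsRestrainedDominating? S ×-dec ∣ S ∣ ≟ k))
    _ (⊤ , (λ _ v∉⊤ → ⊥-elim (v∉⊤ ∈⊤)) , refl)

  γ-rdR : ℕ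
  γ-rdR = proj₁ rdR-minimum

  γ-rdR-isMinimum : IsMinimum (RDRDWeight G) γ-rdR
  γ-rdR-isMinimum = proj₂ rdR-minimum

  γ-r : ℕ
  γ-r = proj₁ r-minimum

  γ-r-isMinimum : IsMinimum (RestrainedDominatingSize G) γ-r
  γ-r-isMinimum = proj₂ r-minimum

{-# OPTIONS --safe #-}
-- Write an RDRD function as f = [f ≠ 0] + c ∘ f with the charge c = (0, 0, 1, 2).  The support
-- of f is restrained dominating, and a vertex of value 0 sees a charge of at least 2, so
-- counting the edges by their charged end gives 2 · #{f = 0} ≤ Δ · Σ c.  Adding up,
-- 2n + Δ |supp f| ≤ Δ w(f) + 2 |supp f|, and for Δ ≥ 2 one may replace |supp f| by γ_r.
-- For Δ = 1 nothing can lie outside a restrained dominating set, so γ_r ≥ n.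
-- The complete graph on Δ + 1 vertices has γ_r = 1, and γ_rdR = 3 by the bound itself.
module Submission where

open import Defs
open import Data.Bool using (Bool; true; false; not)
open import Data.Bool.Properties using (¬-not)
open import Data.Fin using (Fin; zero; suc; toℕ)
open import Data.Fin.Patterns using (0F; 1F; 2F; 3F)
open import Data.Fin.Properties using () renaming (_≟_ to _≟ᶠ_)
open import Data.Fin.Subset using (Subset; _∈_; _∉_; ∣_∣; ⊤; ⁅_⁆; ∁)
open import Data.Fin.Subset.Properties
  using (_∈?_; ∣⊤∣≡n; p⊆q⇒∣p∣≤∣q∣; ∣⁅x⁆∣≡1; ∣∁p∣≡n∸∣p∣; x∈⁅x⁆; x≢y⇒x∉⁅y⁆; x∈⁅y⁆⇒x≡y)
open import Data.Integer using (+_; _+_; _-_; _*_)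
import Data.Integer as ℤ
import Data.Integer.Properties as ℤ
open import Data.Integer.Tactic.RingSolver using () renaming (solve-∀ to solve-∀ℤ)
open import Data.Nat using (ℕ; zero; suc; >-nonZero; s≤s; z≤n; _⊔_) renaming (_≥_ to _≥ⁿ_)
import Data.Nat as ℕ
open import Data.Nat.Properties using (≤-trans)
import Data.Nat.Properties as ℕ
open import Algebra.Properties.CommutativeMonoid.Sum ℕ.+-0-commutativeMonoid using (∑-comm; ∑-distrib-+)
open import Algebra.Properties.Monoid.Sum ℕ.+-0-monoid
  using (sum-cong-≗; sum-replicate-zero) renaming (sum to ∑)
open import Algebra.Properties.Semiring.Sum ℕ.+-*-semiring using (*-distribˡ-sum)
open import Data.Nat.Tactic.RingSolver using (solve-∀)
open import Data.Product using (∃; ∃-syntax; Σ-syntax; _×_; _,_; proj₁; proj₂)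
open import Data.Rational using (_/_; _≥_)
import Data.Rational as ℚ
import Data.Rational.Properties as ℚ
open import Data.Rational.Unnormalised using (mkℚᵘ; *≤*; *≡*)
import Data.Rational.Unnormalised as ℚᵘ
import Data.Rational.Unnormalised.Properties as ℚᵘ
open import Data.Sum using (inj₁; inj₂)
open import Data.Vec using (tabulate; lookup)
open import Data.Vec.Functional using (foldr)
open import Data.Vec.Properties
  using (lookup∘tabulate; tabulate∘lookup; tabulate-cong; []=⇒lookup; lookup⇒[]=; lookup-map)
open import Function using (_∘_; mk⇔)
open import Level using (0ℓ)
open import Relation.Binary.PropositionalEquality
  using (_≡_; _≢_; refl; sym; trans; cong; cong₂; subst)
open import Relation.Nullary using (¬_; yes; no; does; ¬?; contradiction)
open import Relation.Nullary.Decidable using (dec-true; does-⇔; decidable-stable)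
open import Relation.Unary using (Pred; Decidable)

-- Sums, indicator counts and maxima of finite families

∑-mono-≤ : ∀ {n} {s t : Fin n → ℕ} → (∀ i → s i ℕ.≤ t i) → ∑ s ℕ.≤ ∑ t
∑-mono-≤ {zero}  s≤t = z≤n
∑-mono-≤ {suc n} s≤t = ℕ.+-mono-≤ (s≤t zero) (∑-mono-≤ (s≤t ∘ suc))

term≤∑ : ∀ {n} (t : Fin n → ℕ) i → t i ℕ.≤ ∑ t
term≤∑ t zero    = ℕ.m≤m+n _ _
term≤∑ t (suc i) = ≤-trans (term≤∑ (t ∘ suc) i) (ℕ.m≤n+m _ _)

two-terms≤∑ : ∀ {n} (t : Fin n → ℕ) {i j} → i ≢ j → t i ℕ.+ t j ℕ.≤ ∑ t
two-terms≤∑ t {zero}  {zero}  i≢j = contradiction refl i≢j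
two-terms≤∑ t {zero}  {suc j} i≢j = ℕ.+-monoʳ-≤ (t zero) (term≤∑ (t ∘ suc) j)
two-terms≤∑ t {suc i} {zero}  i≢j =
  ≤-trans (ℕ.≤-reflexive (ℕ.+-comm (t (suc i)) (t zero)))
            (ℕ.+-monoʳ-≤ (t zero) (term≤∑ (t ∘ suc) i))
two-terms≤∑ t {suc i} {suc j} i≢j =
  ≤-trans (two-terms≤∑ (t ∘ suc) (i≢j ∘ cong suc)) (ℕ.m≤n+m _ _)

∑-one : ∀ n → ∑ {n} (λ _ → 1) ≡ n
∑-one zero    = refl
∑-one (suc n) = cong suc (∑-one n)

𝟙 : Bool → ℕ
𝟙 false = 0
𝟙 true  = 1

∣tabulate∣ : ∀ {n} (b : Fin n → Bool) → ∣ tabulate b ∣ ≡ ∑ (𝟙 ∘ b)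
∣tabulate∣ {zero}  b = refl
∣tabulate∣ {suc n} b with b zero
... | true  = cong suc (∣tabulate∣ (b ∘ suc))
... | false = ∣tabulate∣ (b ∘ suc)

module _ {n} {P : Pred (Fin n) 0ℓ} (P? : Decidable P) where

  ∈-tabulate⁺ : ∀ {v} → P v → v ∈ tabulate (does ∘ P?)
  ∈-tabulate⁺ {v} p =
    lookup⇒[]= v _ (trans (lookup∘tabulate (does ∘ P?) v) (dec-true (P? v) p))

  ∈-tabulate⁻ : ∀ {v} → v ∈ tabulate (does ∘ P?) → P v
  ∈-tabulate⁻ {v} v∈ with P? v | trans (sym (lookup∘tabulate (does ∘ P?) v)) ([]=⇒lookup v∈)
  ... | yes p | _ = p

term≤max : ∀ {n} (t : Fin n → ℕ) i → t i ℕ.≤ foldr _⊔_ 0 t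
term≤max t zero    = ℕ.m≤m⊔n _ _
term≤max t (suc i) = ≤-trans (term≤max (t ∘ suc) i) (ℕ.m≤n⊔m (t zero) _)

max-const : ∀ {n} (t : Fin (suc n) → ℕ) {k} → (∀ i → t i ≡ k) → foldr _⊔_ 0 t ≡ k
-- The seed 0 of the fold meets only this last term, where it is neutral.
max-const {zero}  t t≡k = trans (ℕ.⊔-identityʳ _) (t≡k zero)
max-const {suc n} t {k} t≡k =
  trans (cong₂ _⊔_ (t≡k zero) (max-const (t ∘ suc) (t≡k ∘ suc))) (ℕ.⊔-idem k)

-- Splitting weight and order along the support

charge : Fin 4 → ℕ
charge 0F = 0
charge 1F = 0
charge 2F = 1
charge 3F = 2

nonzero? : Decidable {A = Fin 4} (_≢ 0F)
nonzero? i = ¬? (i ≟ᶠ 0F)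

support : ∀ {n} → (Fin n → Fin 4) → Subset n
support f = tabulate (does ∘ nonzero? ∘ f)

weight-split : ∀ {n} (f : Fin n → Fin 4) → weight f ≡ ∣ support f ∣ ℕ.+ ∑ (charge ∘ f)
weight-split f =
  trans (sum-cong-≗ (value-split ∘ f))
  (trans (∑-distrib-+ (𝟙 ∘ does ∘ nonzero? ∘ f) (charge ∘ f))
         (cong (ℕ._+ ∑ (charge ∘ f)) (sym (∣tabulate∣ (does ∘ nonzero? ∘ f)))))
  where
  value-split : ∀ i → toℕ i ≡ 𝟙 (does (nonzero? i)) ℕ.+ charge i
  value-split 0F = refl
  value-split 1F = refl
  value-split 2F = refl
  value-split 3F = refl

order-split : ∀ {n} (f : Fin n → Fin 4) → n ≡ ∣ support f ∣ ℕ.+ ∑ (λ v → 𝟙 (does (f v ≟ᶠ 0F)))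
order-split {n} f =
  trans (sym (∑-one n))
  (trans (sum-cong-≗ (λ v → one-split (does (f v ≟ᶠ 0F))))
  (trans (∑-distrib-+ (𝟙 ∘ does ∘ nonzero? ∘ f) (λ v → 𝟙 (does (f v ≟ᶠ 0F))))
         (cong (ℕ._+ ∑ (λ v → 𝟙 (does (f v ≟ᶠ 0F))))
               (sym (∣tabulate∣ (does ∘ nonzero? ∘ f))))))
  where
  one-split : ∀ b → 1 ≡ 𝟙 (not b) ℕ.+ 𝟙 b
  one-split false = refl
  one-split true  = refl

-- Double counting of charges and the lower bound

module _ {n} (G : Graph n) where
  open Graph G

  -- The adjacency matrix with entries in ℕ, so that degrees are row sums.
  adj : Fin n → Fin n → ℕ
  adj v u = 𝟙 (does (v ~? u))

  adj≡1 : ∀ {v u} → v ~ u → adj v u ≡ 1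
  adj≡1 {v} {u} v~u = cong 𝟙 (dec-true (v ~? u) v~u)

  adj-sym : ∀ v u → adj v u ≡ adj u v
  adj-sym v u = cong 𝟙 (does-⇔ (mk⇔ ~-sym ~-sym) (v ~? u) (u ~? v))

  degree≡∑adj : ∀ v → degree G v ≡ ∑ (adj v)
  degree≡∑adj v = ∣tabulate∣ (λ u → does (v ~? u))

  ∑adj≤maxDegree : ∀ v → ∑ (adj v) ℕ.≤ maxDegree G
  ∑adj≤maxDegree v = subst (ℕ._≤ maxDegree G) (degree≡∑adj v) (term≤max (degree G) v)

  -- Double counting: each u contributes its charge c u once per neighbour.
  ∑-charge≤ : (c : Fin n → ℕ) →
    ∑ (λ v → ∑ (λ u → c u ℕ.* adj v u)) ℕ.≤ maxDegree G ℕ.* ∑ c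
  ∑-charge≤ c = begin
    ∑ (λ v → ∑ (λ u → c u ℕ.* adj v u))
      ≡⟨ ∑-comm (λ v u → c u ℕ.* adj v u) ⟩
    ∑ (λ u → ∑ (λ v → c u ℕ.* adj v u))
      ≤⟨ ∑-mono-≤ at ⟩
    ∑ (λ u → maxDegree G ℕ.* c u)
      ≡⟨ sym (*-distribˡ-sum (maxDegree G) c) ⟩
    maxDegree G ℕ.* ∑ c ∎
    where
    open ℕ.≤-Reasoning
    at : ∀ u → ∑ (λ v → c u ℕ.* adj v u) ℕ.≤ maxDegree G ℕ.* c u
    at u = begin
      ∑ (λ v → c u ℕ.* adj v u)
        -- Symmetry turns the column sum at `u` into the row sum, which is its degree.
        ≡⟨ sum-cong-≗ (λ v → cong (c u ℕ.*_) (adj-sym v u)) ⟩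
      ∑ (λ v → c u ℕ.* adj u v)   ≡⟨ sym (*-distribˡ-sum (c u) (adj u)) ⟩
      c u ℕ.* ∑ (adj u)           ≤⟨ ℕ.*-monoʳ-≤ (c u) (∑adj≤maxDegree u) ⟩
      c u ℕ.* maxDegree G         ≡⟨ ℕ.*-comm (c u) _ ⟩
      maxDegree G ℕ.* c u         ∎

  module _ {f : Fin n → Fin 4} (r : IsRDRD G f) where
    open IsRDRD r

    private
      seen : Fin n → Fin n → ℕ
      seen v u = charge (f u) ℕ.* adj v u

      seen≡charge : ∀ {v u i} → v ~ u → f u ≡ i → seen v u ≡ charge i
      seen≡charge v~u fu = trans (cong₂ ℕ._*_ (cong charge fu) (adj≡1 v~u)) (ℕ.*-identityʳ _)

      -- Two neighbours of value 2 and a single neighbour of value 3 each supply exactly 2; the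
      -- values of `charge` are chosen for this.
      charge-seen : ∀ v → f v ≡ 0F → 2 ℕ.≤ ∑ (seen v)
      charge-seen v fv with zero-dominated v fv
      ... | inj₁ (u , w , u≢w , (v~u , fu) , (v~w , fw)) =
        subst (ℕ._≤ ∑ (seen v)) (cong₂ ℕ._+_ (seen≡charge v~u fu) (seen≡charge v~w fw))
              -- Both terms may be counted because the two dominating neighbours are distinct.
              (two-terms≤∑ (seen v) u≢w)
      ... | inj₂ (u , v~u , fu) =
        subst (ℕ._≤ ∑ (seen v)) (seen≡charge v~u fu) (term≤∑ (seen v) u)

      -- For nonzero `f v` the left side vanishes, so the inequality can be summed over all
      -- vertices.
      two-zero≤ : ∀ v → 2 ℕ.* 𝟙 (does (f v ≟ᶠ 0F)) ℕ.≤ ∑ (seen v)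
      two-zero≤ v with f v ≟ᶠ 0F
      ... | yes fv = charge-seen v fv
      ... | no _   = z≤n

    zeros-charged : 2 ℕ.* ∑ (λ v → 𝟙 (does (f v ≟ᶠ 0F))) ℕ.≤ maxDegree G ℕ.* ∑ (charge ∘ f)
    zeros-charged =
      ≤-trans (ℕ.≤-reflexive (*-distribˡ-sum 2 (λ v → 𝟙 (does (f v ≟ᶠ 0F)))))
      (≤-trans (∑-mono-≤ two-zero≤) (∑-charge≤ (charge ∘ f)))

    -- A vertex outside the support has value 0. Its dominating neighbour has value 2 or 3 and lies
    -- in the support, while `restrained` supplies a neighbour outside.
    support-restrainedDominating : IsRestrainedDominating G (support f)
    support-restrainedDominating v v∉S = dominated , undominated
      where
      S? = nonzero? ∘ f

      fv≡0 : f v ≡ 0F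
      fv≡0 = decidable-stable (f v ≟ᶠ 0F) (v∉S ∘ ∈-tabulate⁺ S?)

      ∈S : ∀ {u i} → f u ≡ i → i ≢ 0F → u ∈ support f
      ∈S refl i≢0 = ∈-tabulate⁺ S? i≢0

      dominated : ∃[ u ] v ~ u × u ∈ support f
      dominated with zero-dominated v fv≡0
      ... | inj₁ (u , _ , _ , (v~u , fu) , _) = u , v~u , ∈S fu (λ ())
      ... | inj₂ (u , v~u , fu)               = u , v~u , ∈S fu (λ ())

      undominated : ∃[ u ] v ~ u × u ∉ support f
      undominated with restrained v fv≡0
      ... | u , v~u , fu = u , v~u , λ u∈S → ∈-tabulate⁻ S? u∈S fu

    -- This is `zeros-charged` with `D * S + 2 * S` added to both sides: the zeros complete the
    -- support to `n`, and the charges complete it to the weight.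
    weight-bound :
      2 ℕ.* n ℕ.+ maxDegree G ℕ.* ∣ support f ∣ ℕ.≤ maxDegree G ℕ.* weight f ℕ.+ 2 ℕ.* ∣ support f ∣
    weight-bound = begin
      2 ℕ.* n ℕ.+ D ℕ.* S            ≡⟨ cong (λ m → 2 ℕ.* m ℕ.+ D ℕ.* S) (order-split f) ⟩
      2 ℕ.* (S ℕ.+ Z) ℕ.+ D ℕ.* S    ≡⟨ regroup₁ S Z D ⟩
      2 ℕ.* Z ℕ.+ (D ℕ.* S ℕ.+ 2 ℕ.* S) ≤⟨ ℕ.+-monoˡ-≤ _ zeros-charged ⟩
      D ℕ.* C ℕ.+ (D ℕ.* S ℕ.+ 2 ℕ.* S) ≡⟨ regroup₂ S C D ⟩
      D ℕ.* (S ℕ.+ C) ℕ.+ 2 ℕ.* S    ≡⟨ cong (λ w → D ℕ.* w ℕ.+ 2 ℕ.* S) (sym (weight-split f)) ⟩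
      D ℕ.* weight f ℕ.+ 2 ℕ.* S     ∎
      where
      open ℕ.≤-Reasoning
      D = maxDegree G
      S = ∣ support f ∣
      Z = ∑ (λ v → 𝟙 (does (f v ≟ᶠ 0F)))
      C = ∑ (charge ∘ f)

      regroup₁ : ∀ s z d → 2 ℕ.* (s ℕ.+ z) ℕ.+ d ℕ.* s ≡ 2 ℕ.* z ℕ.+ (d ℕ.* s ℕ.+ 2 ℕ.* s)
      regroup₁ = solve-∀

      regroup₂ : ∀ s c d → d ℕ.* c ℕ.+ (d ℕ.* s ℕ.+ 2 ℕ.* s) ≡ d ℕ.* (s ℕ.+ c) ℕ.+ 2 ℕ.* s
      regroup₂ = solve-∀

  -- A vertex outside S has neighbours both inside and outside S, hence degree at least 2.
  restrainedDominating-full : ∀ {S} → maxDegree G ℕ.≤ 1 → IsRestrainedDominating G S → n ℕ.≤ ∣ S ∣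
  restrainedDominating-full {S} Δ≤1 rd =
    subst (ℕ._≤ ∣ S ∣) (∣⊤∣≡n n)
          (p⊆q⇒∣p∣≤∣q∣ {p = ⊤} λ {v} _ → decidable-stable (v ∈? S) (¬outside v))
    where
    ¬outside : ∀ v → ¬ (v ∉ S)
    ¬outside v v∉S with rd v v∉S
    ... | (u , v~u , u∈S) , (w , v~w , w∉S) = contradiction Δ≤1 (ℕ.<⇒≱ 2≤Δ)
      where
      2≤Δ : 2 ℕ.≤ maxDegree G
      2≤Δ = ≤-trans
        (subst (ℕ._≤ ∑ (adj v)) (cong₂ ℕ._+_ (adj≡1 v~u) (adj≡1 v~w))
               -- The two neighbours differ because only one of them lies in `S`.
               (two-terms≤∑ (adj v) (λ { refl → w∉S u∈S })))
        (∑adj≤maxDegree v)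

  -- The bound cleared of its denominator, with 2 γ moved to the right to avoid subtraction.
  minima-bound : ∀ {w γ} Δ → maxDegree G ≡ Δ → Δ ≥ⁿ 1 →
    RDRDWeight G w → IsMinimum (RestrainedDominatingSize G) γ →
    2 ℕ.* n ℕ.+ Δ ℕ.* γ ℕ.≤ Δ ℕ.* w ℕ.+ 2 ℕ.* γ
  minima-bound {w} {γ} Δ Δ≡ Δ≥1 (f , r , wf) ((T , rdT , ∣T∣) , γ-min) = go Δ Δ≡ Δ≥1
    where
    open ℕ.≤-Reasoning
    S = ∣ support f ∣

    γ≤S : γ ℕ.≤ S
    γ≤S = γ-min S (support f , support-restrainedDominating r , refl)

    S≤w : S ℕ.≤ w
    S≤w = subst (S ℕ.≤_) (trans (sym (weight-split f)) wf) (ℕ.m≤m+n S _)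

    -- The sign of Δ - 2 decides whether the support may be replaced by a smaller set. For Δ = 1 it
    -- is negative, and the chain n ≤ γ ≤ w is used instead; otherwise Δ - 2 is written as `k`.
    go : ∀ Δ → maxDegree G ≡ Δ → Δ ≥ⁿ 1 → 2 ℕ.* n ℕ.+ Δ ℕ.* γ ℕ.≤ Δ ℕ.* w ℕ.+ 2 ℕ.* γ
    go 1 Δ≡ _ = begin
      2 ℕ.* n ℕ.+ 1 ℕ.* γ   ≤⟨ ℕ.+-monoˡ-≤ (1 ℕ.* γ) (ℕ.*-monoʳ-≤ 2 n≤γ) ⟩
      2 ℕ.* γ ℕ.+ 1 ℕ.* γ   ≤⟨ ℕ.+-monoʳ-≤ (2 ℕ.* γ) (ℕ.*-monoʳ-≤ 1 (≤-trans γ≤S S≤w)) ⟩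
      2 ℕ.* γ ℕ.+ 1 ℕ.* w   ≡⟨ ℕ.+-comm (2 ℕ.* γ) _ ⟩
      1 ℕ.* w ℕ.+ 2 ℕ.* γ   ∎
      where
      n≤γ : n ℕ.≤ γ
      n≤γ = subst (n ℕ.≤_) ∣T∣ (restrainedDominating-full (ℕ.≤-reflexive Δ≡) rdT)
    go Δ@(suc (suc k)) Δ≡ _ = begin
      2 ℕ.* n ℕ.+ Δ ℕ.* γ                ≡⟨ split n γ k ⟩
      2 ℕ.* n ℕ.+ k ℕ.* γ ℕ.+ 2 ℕ.* γ    ≤⟨ ℕ.+-monoˡ-≤ (2 ℕ.* γ) without-two ⟩
      Δ ℕ.* w ℕ.+ 2 ℕ.* γ                ∎
      where
      split : ∀ m s k → 2 ℕ.* m ℕ.+ suc (suc k) ℕ.* s ≡ 2 ℕ.* m ℕ.+ k ℕ.* s ℕ.+ 2 ℕ.* s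
      split = solve-∀

      full : 2 ℕ.* n ℕ.+ k ℕ.* S ℕ.+ 2 ℕ.* S ℕ.≤ Δ ℕ.* w ℕ.+ 2 ℕ.* S
      full = begin
        2 ℕ.* n ℕ.+ k ℕ.* S ℕ.+ 2 ℕ.* S  ≡⟨ sym (split n S k) ⟩
        2 ℕ.* n ℕ.+ Δ ℕ.* S
          ≤⟨ subst (λ d → 2 ℕ.* n ℕ.+ d ℕ.* S ℕ.≤ d ℕ.* weight f ℕ.+ 2 ℕ.* S) Δ≡ (weight-bound r) ⟩
        Δ ℕ.* weight f ℕ.+ 2 ℕ.* S       ≡⟨ cong (λ x → Δ ℕ.* x ℕ.+ 2 ℕ.* S) wf ⟩
        Δ ℕ.* w ℕ.+ 2 ℕ.* S              ∎

      -- Once `2 * S` is cancelled, `S` occurs only on the smaller side, with coefficient `k`, so it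
      -- can be lowered to `γ`.
      without-two : 2 ℕ.* n ℕ.+ k ℕ.* γ ℕ.≤ Δ ℕ.* w
      without-two = begin
        2 ℕ.* n ℕ.+ k ℕ.* γ  ≤⟨ ℕ.+-monoʳ-≤ (2 ℕ.* n) (ℕ.*-monoʳ-≤ k γ≤S) ⟩
        2 ℕ.* n ℕ.+ k ℕ.* S  ≤⟨ ℕ.+-cancelʳ-≤ (2 ℕ.* S) _ _ full ⟩
        Δ ℕ.* w              ∎

-- Sharpness on complete graphs

complete : ∀ n → Graph n
complete n = record
  { _~_      = _≢_
  ; ~-sym    = λ u≢v → u≢v ∘ sym
  ; ~-irrefl = λ u≡v u≢v → u≢v u≡v
  ; _~?_     = λ u v → ¬? (u ≟ᶠ v)
  }

-- The neighbourhood of `v` agrees entry by entry with the complement of the singleton of `v`.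
complete-degree : ∀ {n} v → degree (complete (suc n)) v ≡ n
complete-degree {n} v =
  trans (cong ∣_∣ (trans (tabulate-cong pointwise) (tabulate∘lookup (∁ ⁅ v ⁆))))
  (trans (∣∁p∣≡n∸∣p∣ ⁅ v ⁆) (cong (suc n ℕ.∸_) (∣⁅x⁆∣≡1 v)))
  where
  in-singleton : ∀ u → does (v ≟ᶠ u) ≡ lookup ⁅ v ⁆ u
  in-singleton u with v ≟ᶠ u
  ... | yes refl = sym ([]=⇒lookup (x∈⁅x⁆ v))
  ... | no v≢u   = sym (¬-not (x≢y⇒x∉⁅y⁆ (v≢u ∘ sym) ∘ lookup⇒[]= u ⁅ v ⁆))

  pointwise : ∀ u → not (does (v ≟ᶠ u)) ≡ lookup (∁ ⁅ v ⁆) u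
  pointwise u = trans (cong not (in-singleton u)) (sym (lookup-map u not ⁅ v ⁆))

complete-maxDegree : ∀ n → maxDegree (complete (suc n)) ≡ n
complete-maxDegree n = max-const (degree (complete (suc n))) complete-degree

-- Equality in the cleared bound for Δ = 2 + k, order Δ + 1, weight 3 and γ = 1: both sides are 3Δ +
-- 2.
complete-tight : ∀ k → (2 ℕ.+ k) ℕ.* 3 ℕ.+ 2 ≡ 2 ℕ.* (3 ℕ.+ k) ℕ.+ (2 ℕ.+ k) ℕ.* 1
complete-tight = solve-∀

module _ (k : ℕ) where
  private
    K = complete (3 ℕ.+ k)

    -- A third vertex, which serves as the neighbour of `v` outside the dominating set consisting of
    -- `zero`.
    another : (v : Fin (3 ℕ.+ k)) → v ≢ zero → ∃[ u ] v ≢ u × u ≢ zero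
    another zero          v≢0 = contradiction refl v≢0
    another (suc zero)    _   = suc (suc zero) , (λ ()) , (λ ())
    another (suc (suc v)) _   = suc zero , (λ ()) , (λ ())

    centre : Fin (3 ℕ.+ k) → Fin 4
    centre zero    = 3F
    centre (suc _) = 0F

    centre≡0⇒≢zero : ∀ {v} → centre v ≡ 0F → v ≢ zero
    centre≡0⇒≢zero () refl

    ≢zero⇒centre≡0 : ∀ {v} → v ≢ zero → centre v ≡ 0F
    ≢zero⇒centre≡0 {zero}  v≢0 = contradiction refl v≢0
    ≢zero⇒centre≡0 {suc v} _   = refl

    centre-RDRD : IsRDRD K centre
    centre-RDRD = record
      { zero-dominated = λ v cv → inj₂ (zero , centre≡0⇒≢zero cv , refl)
      ; one-dominated  = λ { zero () ; (suc _) () }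
      ; restrained     = λ v cv → let (u , v≢u , u≢0) = another v (centre≡0⇒≢zero cv)
                                  in u , v≢u , ≢zero⇒centre≡0 u≢0
      }

    centre-dominating : IsRestrainedDominating K ⁅ zero ⁆
    centre-dominating v v∉ = (zero , v≢0 , x∈⁅x⁆ zero) ,
      (let (u , v≢u , u≢0) = another v v≢0 in u , v≢u , x≢y⇒x∉⁅y⁆ u≢0)
      where
      v≢0 : v ≢ zero
      v≢0 refl = v∉ (x∈⁅x⁆ zero)

    dominating-nonempty : ∀ {S} → IsRestrainedDominating K S → ∃ (_∈ S)
    dominating-nonempty {S} rd with zero ∈? S
    ... | yes 0∈S = zero , 0∈S
    ... | no  0∉S = let ((u , _ , u∈S) , _) = rd zero 0∉S in u , u∈S

  -- One vertex suffices, and a dominating set is nonempty, hence contains a singleton.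
  complete-γ-r : ∀ {γ} → IsMinimum (RestrainedDominatingSize K) γ → γ ≡ 1
  complete-γ-r {γ} ((S , rd , ∣S∣) , γ-min) = ℕ.≤-antisym
    (γ-min 1 (⁅ zero ⁆ , centre-dominating , ∣⁅x⁆∣≡1 {3 ℕ.+ k} zero))
    (let (v , v∈S) = dominating-nonempty rd in
     subst (ℕ._≤ γ) (∣⁅x⁆∣≡1 v)
       (subst (∣ ⁅ v ⁆ ∣ ℕ.≤_) ∣S∣
         (p⊆q⇒∣p∣≤∣q∣ λ x∈ → subst (_∈ S) (sym (x∈⁅y⁆⇒x≡y v x∈)) v∈S)))

  -- `centre` has weight 3. Conversely, `minima-bound` at γ = 1 gives 3Δ ≤ Δw, and the positive
  -- factor Δ cancels.
  complete-γ-rdR : ∀ {w γ} → IsMinimum (RDRDWeight K) w →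
    IsMinimum (RestrainedDominatingSize K) γ → w ≡ 3
  complete-γ-rdR {w} {γ} (weight-w , w-min) isMin-γ = ℕ.≤-antisym
    (w-min 3
      (centre , centre-RDRD , cong (3 ℕ.+_) (sum-replicate-zero (2 ℕ.+ k))))
    (ℕ.*-cancelˡ-≤ Δ (ℕ.+-cancelʳ-≤ 2 _ _ Δ3≤Δw))
    where
    Δ = 2 ℕ.+ k
    open ℕ.≤-Reasoning

    Δ3≤Δw : Δ ℕ.* 3 ℕ.+ 2 ℕ.≤ Δ ℕ.* w ℕ.+ 2
    Δ3≤Δw = begin
      Δ ℕ.* 3 ℕ.+ 2                      ≡⟨ complete-tight k ⟩
      2 ℕ.* (3 ℕ.+ k) ℕ.+ Δ ℕ.* 1
        ≤⟨ subst (λ g → 2 ℕ.* (3 ℕ.+ k) ℕ.+ Δ ℕ.* g ℕ.≤ Δ ℕ.* w ℕ.+ 2 ℕ.* g)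
             (complete-γ-r isMin-γ)
             (minima-bound K Δ (complete-maxDegree Δ) (s≤s z≤n) weight-w isMin-γ) ⟩
      Δ ℕ.* w ℕ.+ 2                      ∎

-- From natural numbers to the rational quotient

-- Δ - 2 is an integer, -1 for Δ = 1. Splitting off 2γ exposes the left side of `minima-bound`.
numerator : ∀ n Δ γ →
  + 2 * + n + (+ Δ - + 2) * + γ ≡ + (2 ℕ.* n ℕ.+ Δ ℕ.* γ) - + (2 ℕ.* γ)
numerator n Δ γ =
  trans (expand (+ n) (+ Δ) (+ γ)) (sym (cong₂ _-_
    (trans (ℤ.pos-+ (2 ℕ.* n) (Δ ℕ.* γ)) (cong₂ _+_ (ℤ.pos-* 2 n) (ℤ.pos-* Δ γ)))
    (ℤ.pos-* 2 γ)))
  where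
  expand : ∀ a d g → + 2 * a + (d - + 2) * g ≡ (+ 2 * a + d * g) - + 2 * g
  expand = solve-∀ℤ

pos-cancel : ∀ a b → + (a ℕ.+ b) - + b ≡ + a
pos-cancel a b = trans (cong (_- + b) (ℤ.pos-+ a b)) (cancel (+ a) (+ b))
  where
  cancel : ∀ x y → (x + y) - y ≡ x
  cancel = solve-∀ℤ

-- Normalising a fraction preserves its value, so inequalities can be checked by cross-multiplying
-- unreduced fractions.
fromℚᵘ-mono-≤ : ∀ {p q} → p ℚᵘ.≤ q → ℚ.fromℚᵘ p ℚ.≤ ℚ.fromℚᵘ q
fromℚᵘ-mono-≤ {p} {q} p≤q = ℚ.toℚᵘ-cancel-≤
  (ℚᵘ.≤-respˡ-≃ (ℚᵘ.≃-sym (ℚ.toℚᵘ-fromℚᵘ p)) (ℚᵘ.≤-respʳ-≃ (ℚᵘ.≃-sym (ℚ.toℚᵘ-fromℚᵘ q)) p≤q))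

module _ (n d γ w : ℕ) where
  private
    Δ = suc d
    num = + 2 * + n + (+ Δ - + 2) * + γ

    right : + (Δ ℕ.* w ℕ.+ 2 ℕ.* γ) - + (2 ℕ.* γ) ≡ + w * + Δ
    right = trans (pos-cancel (Δ ℕ.* w) (2 ℕ.* γ)) (trans (ℤ.pos-* Δ w) (ℤ.*-comm (+ Δ) (+ w)))

    left : num * + 1 ≡ + (2 ℕ.* n ℕ.+ Δ ℕ.* γ) - + (2 ℕ.* γ)
    left = trans (ℤ.*-identityʳ num) (numerator n Δ γ)

  fraction-≤ : 2 ℕ.* n ℕ.+ Δ ℕ.* γ ℕ.≤ Δ ℕ.* w ℕ.+ 2 ℕ.* γ → num / Δ ℚ.≤ + w / 1
  -- `mkℚᵘ` stores the denominator minus one: `d` stands for Δ and 0 for 1.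
  fraction-≤ h = fromℚᵘ-mono-≤ {mkℚᵘ num d} {mkℚᵘ (+ w) 0} (*≤* (begin
    num * + 1                                        ≡⟨ left ⟩
    + (2 ℕ.* n ℕ.+ Δ ℕ.* γ) - + (2 ℕ.* γ)            ≤⟨ ℤ.+-monoˡ-≤ (ℤ.- + (2 ℕ.* γ)) (ℤ.+≤+ h) ⟩
    + (Δ ℕ.* w ℕ.+ 2 ℕ.* γ) - + (2 ℕ.* γ)            ≡⟨ right ⟩
    + w * + Δ                                        ∎))
    where open ℤ.≤-Reasoning

  fraction-≡ : Δ ℕ.* w ℕ.+ 2 ℕ.* γ ≡ 2 ℕ.* n ℕ.+ Δ ℕ.* γ → + w / 1 ≡ num / Δ
  fraction-≡ h = ℚ.fromℚᵘ-cong {mkℚᵘ (+ w) 0} {mkℚᵘ num d}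
    (*≡* (trans (sym right) (trans (cong (λ m → + m - + (2 ℕ.* γ)) h) (sym left))))

theorem2p4 : (∀ {n} (G : Graph n) (Δ : ℕ) → maxDegree G ≡ Δ → (Δ≥1 : Δ ≥ⁿ 1) →
    (+ γ-rdR G) / 1 ≥ _/_ (+ 2 * + n + (+ Δ - + 2) * + γ-r G) Δ {{>-nonZero Δ≥1}})
    ×
    (∀ (Δ : ℕ) (Δ≥4 : Δ ≥ⁿ 4) →
    ∃[ n ] Σ[ G ∈ Graph n ]
    maxDegree G ≡ Δ ×
    (+ γ-rdR G) / 1 ≡ _/_ (+ 2 * + n + (+ Δ - + 2) * + γ-r G) Δ {{>-nonZero (≤-trans (s≤s z≤n) Δ≥4)}})
theorem2p4 = bound , sharp
  where
  bound : ∀ {n} (G : Graph n) (Δ : ℕ) → maxDegree G ≡ Δ → (Δ≥1 : Δ ≥ⁿ 1) →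
    (+ γ-rdR G) / 1 ≥ _/_ (+ 2 * + n + (+ Δ - + 2) * + γ-r G) Δ {{>-nonZero Δ≥1}}
  bound {n} G (suc d) Δ≡ Δ≥1 = fraction-≤ n d (γ-r G) (γ-rdR G)
    (minima-bound G (suc d) Δ≡ Δ≥1 (proj₁ (γ-rdR-isMinimum G)) (γ-r-isMinimum G))

  sharp : ∀ (Δ : ℕ) (Δ≥4 : Δ ≥ⁿ 4) →
    ∃[ n ] Σ[ G ∈ Graph n ]
    maxDegree G ≡ Δ ×
    (+ γ-rdR G) / 1 ≡ _/_ (+ 2 * + n + (+ Δ - + 2) * + γ-r G) Δ {{>-nonZero (≤-trans (s≤s z≤n) Δ≥4)}}
  sharp 1 (s≤s ())
  sharp (suc (suc k)) Δ≥4 = suc Δ , K , complete-maxDegree Δ ,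
    at-3-1 (complete-γ-rdR k (γ-rdR-isMinimum K) (γ-r-isMinimum K)) (complete-γ-r k (γ-r-isMinimum K))
    where
    Δ = 2 ℕ.+ k
    K = complete (suc Δ)

    -- With variables in place of the two minima of `K`, their values 3 and 1 can be substituted by
    -- matching on `refl`.
    at-3-1 : ∀ {w γ} → w ≡ 3 → γ ≡ 1 → + w / 1 ≡ (+ 2 * + suc Δ + (+ Δ - + 2) * + γ) / Δ
    at-3-1 refl refl = fraction-≡ (suc Δ) (suc k) 1 3 (complete-tight k)
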